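{- Let $G$ be a connected trivially perfect graph with $m$ edges. Then $\delta(\mathcal{A}(G)) = \Theta(m)$; that is, there are absolute constants $c_1,c_2>0$ such that $c_1 m \le \delta(\mathcal{A}(G)) \le c_2 m$ for every such graph $G$ with $m \ge 1$.
   Context: All graphs are finite, simple and connected. For a graph $G=(V,E)$, a search tree on $G$ is a rooted tree with vertex set $V$ defined recursively: its root is some vertex $r\in V$, and $r$ is joined to the roots of search trees on each connected component of $G-r$. The tubes of a search tree are the vertex sets of its subtrees (a vertex with all its descendants). Two search trees on $G$ are related by a rotation if their sets of tubes have symmetric difference of size exactly two (equivalently: for a parent $a$ of $b$ with subtree vertex set $A$, one makes $b$ the root of the subtree on $G[A]$, $a$ becomes the root of the subtree on the component of $G[A]-b$ containing $a$, and the subtrees hanging below $b$ are reattached to $a$ or $b$ according to which component of $G[A]-b$ they lie in). The graph associahedron $\mathcal{A}(G)$ is a polytope whose skeleton (vertex–edge graph) is isomorphic to the graph whose vertices are the search trees on $G$, two being adjacent when related by a rotation. $\delta(\mathcal{A}(G))$ denotes the diameter of this graph, i.e. the maximum over pairs of search trees of the minimum number of rotations transforming one into the other. A graph is trivially perfect if it can be built recursively from single vertices by (i) adding a new vertex adjacent to all existing vertices and (ii) taking disjoint unions of two trivially perfect graphs. -}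

module Defs where

open import Data.Nat using (ℕ; zero; suc; _+_; _*_; _≤_; _<ᵇ_)
open import Data.Bool using (Bool; true; false; _∧_; if_then_else_)
open import Data.Fin using (Fin; zero; suc; toℕ; splitAt)
open import Data.Fin.Subset using (Subset; _∈_; _∉_; _⊆_; ⁅_⁆; _∪_; ⊤; _-_; Nonempty)
open import Data.List using (List; []; _∷_; map; allFin; _++_)
open import Data.Nat.ListAction using (sum)
open import Data.List.Membership.Propositional using () renaming (_∈_ to _∈ₗ_; _∉_ to _∉ₗ_)
open import Data.List.Relation.Unary.Any using (Any)
open import Data.List.Relation.Unary.AllPairs using (AllPairs)
open import Data.Product using (Σ; _×_; ∃; _,_; proj₁)
open import Data.Sum using (inj₁; inj₂)
open import Data.Empty using (⊥)
open import Data.Unit using () renaming (⊤ to Unit)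
open import Relation.Binary.PropositionalEquality using (_≡_)
open import Function.Bundles using (_↔_; Inverse)

Adj : ℕ → Set
Adj n = Fin n → Fin n → Bool

IsSimple : ∀ {n} → Adj n → Set
IsSimple {n} G = (∀ i j → G i j ≡ G j i) × (∀ i → G i i ≡ false)

edges : ∀ {n} → Adj n → ℕ
edges {n} G = sum (map (λ i → sum (map (λ j → if G i j ∧ (toℕ i <ᵇ toℕ j) then 1 else 0) (allFin n))) (allFin n))

data Path {n} (G : Adj n) (S : Subset n) : Fin n → Fin n → Set where
  here : ∀ {u} → u ∈ S → Path G S u u
  step : ∀ {u w v} → u ∈ S → G u w ≡ true → Path G S w v → Path G S u v

ConnectedOn : ∀ {n} → Adj n → Subset n → Set
ConnectedOn G S = ∀ u v → u ∈ S → v ∈ S → Path G S u v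

Connected : ∀ {n} → Adj n → Set
Connected G = ConnectedOn G ⊤

IsComponent : ∀ {n} → Adj n → Subset n → Subset n → Set
IsComponent G S C = C ⊆ S × Nonempty C × ConnectedOn G C
                    × (∀ u w → u ∈ C → w ∈ S → G u w ≡ true → w ∈ C)

Disjoint : ∀ {n} → Subset n → Subset n → Set
Disjoint A B = ∀ v → v ∈ A → v ∈ B → ⊥

data Tree (n : ℕ) : Set where
  node : Fin n → List (Tree n) → Tree n

mutual
  verts : ∀ {n} → Tree n → Subset n
  verts (node r ts) = ⁅ r ⁆ ∪ vertsL ts

  vertsL : ∀ {n} → List (Tree n) → Subset n
  vertsL [] = Data.Fin.Subset.⊥
  vertsL (t ∷ ts) = verts t ∪ vertsL ts

mutual
  tubes : ∀ {n} → Tree n → List (Subset n)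
  tubes (node r ts) = verts (node r ts) ∷ tubesL ts

  tubesL : ∀ {n} → List (Tree n) → List (Subset n)
  tubesL [] = []
  tubesL (t ∷ ts) = tubes t ++ tubesL ts

-- IsSearchTree G S t : t is a search tree on G[S]
-- (root r ∈ S; the children are search trees on the connected components of G[S] - r,
--  one for each component)
mutual
  IsSearchTree : ∀ {n} → Adj n → Subset n → Tree n → Set
  IsSearchTree G S (node r ts) =
    r ∈ S × ChildrenOK G (S - r) ts
    × AllPairs (λ t u → Disjoint (verts t) (verts u)) ts
    × (∀ v → v ∈ (S - r) → Any (λ t → v ∈ verts t) ts)

  ChildrenOK : ∀ {n} → Adj n → Subset n → List (Tree n) → Set
  ChildrenOK G S' [] = Unit
  ChildrenOK G S' (t ∷ ts) =
    (IsComponent G S' (verts t) × IsSearchTree G (verts t) t) × ChildrenOK G S' ts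

-- search trees on G (G is connected)
SearchTree : ∀ {n} → Adj n → Set
SearchTree {n} G = Σ (Tree n) (IsSearchTree G ⊤)

tubesOf : ∀ {n} {G : Adj n} → SearchTree G → List (Subset n)
tubesOf T = tubes (proj₁ T)

SameTree : ∀ {n} {G : Adj n} → SearchTree G → SearchTree G → Set
SameTree T T' = ∀ X → (X ∈ₗ tubesOf T → X ∈ₗ tubesOf T') × (X ∈ₗ tubesOf T' → X ∈ₗ tubesOf T)

Rotation : ∀ {n} {G : Adj n} → SearchTree G → SearchTree G → Set
Rotation {n} T T' =
  Σ (Subset n) λ X → Σ (Subset n) λ Y →
    X ∈ₗ tubesOf T × X ∉ₗ tubesOf T' × Y ∈ₗ tubesOf T' × Y ∉ₗ tubesOf T
    × (∀ Z → Z ∈ₗ tubesOf T → Z ∉ₗ tubesOf T' → Z ≡ X)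
    × (∀ Z → Z ∈ₗ tubesOf T' → Z ∉ₗ tubesOf T → Z ≡ Y)

data Rotations {n} {G : Adj n} : ℕ → SearchTree G → SearchTree G → Set where
  done : ∀ {T T'} → SameTree T T' → Rotations 0 T T'
  step : ∀ {k T U T'} → Rotation T U → Rotations k U T' → Rotations (suc k) T T'

single : Adj 1
single _ _ = false

cone : ∀ {n} → Adj n → Adj (suc n)
cone G zero zero = false
cone G zero (suc j) = true
cone G (suc i) zero = true
cone G (suc i) (suc j) = G i j

disjointUnion : ∀ {a b} → Adj a → Adj b → Adj (a + b)
disjointUnion {a} G H i j with splitAt a i | splitAt a j
... | inj₁ x | inj₁ y = G x y
... | inj₂ x | inj₂ y = H x y
... | inj₁ _ | inj₂ _ = false
... | inj₂ _ | inj₁ _ = false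

Isomorphic : ∀ {n} → Adj n → Adj n → Set
Isomorphic {n} G H = Σ (Fin n ↔ Fin n) λ σ → ∀ i j → H (Inverse.to σ i) (Inverse.to σ j) ≡ G i j

data TriviallyPerfect : ∀ {n} → Adj n → Set where
  tp-single : TriviallyPerfect single
  tp-cone   : ∀ {n} {G : Adj n} → TriviallyPerfect G → TriviallyPerfect (cone G)
  tp-union  : ∀ {a b} {G : Adj a} {H : Adj b} → TriviallyPerfect G → TriviallyPerfect H
              → TriviallyPerfect (disjointUnion G H)
  tp-iso    : ∀ {n} {G H : Adj n} → TriviallyPerfect G → Isomorphic G H → TriviallyPerfect H

-- The endpoints of an edge are comparable in every search tree, and a rotation reorients
-- at most one edge. Two search trees that delete the vertices in opposite orders orient all
-- edges oppositely, so their distance is at least m (this holds for every connected G).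
--
-- For the upper bound, call a search tree a heap if the root of each of its subtrees has
-- minimal depth in that subtree, the depth coming from the recursive construction of G. Such
-- a root is adjacent to the whole tube, which forces the heap to be unique. A subtree that is
-- not a heap but whose child subtrees are has a single child, and rotating that child to the
-- top corrects one wrongly oriented edge and spoils none. Hence every search tree is at
-- distance at most m from the heap.
module Submission where

open import Defs
open import Data.Nat using (ℕ; zero; suc; _+_; _*_; _∸_; _≤_; _<_; _<?_; _<ᵇ_; z≤n; s≤s)
open import Data.Nat.Properties using (≤-refl; ≤-reflexive; ≤-trans; ≤-antisym; <-irrefl; <-asym; <-cmp; ≮⇒≥; ≤∧≢⇒<; <⇒≱; <⇒≤; +-mono-≤; +-mono-<-≤; +-mono-≤-<; +-suc; +-identityʳ; suc-injective; ∸-monoʳ-<; <ᵇ⇒<; <⇒<ᵇ)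
open import Data.Nat.Induction using (<-wellFounded)
open import Data.Nat.ListAction using (sum)
open import Induction.WellFounded using (Acc; acc)
open import Data.Bool using (Bool; true; false; T; _∧_; if_then_else_)
open import Data.Bool.Properties using (T-≡; T-∧) renaming (_≟_ to _≟ᵇ_)
open import Data.Fin using (Fin; zero; suc; toℕ; splitAt; _≟_)
open import Data.Fin.Properties using (any?; toℕ<n; toℕ-injective; splitAt⁻¹-↑ˡ; splitAt⁻¹-↑ʳ)
open import Data.Fin.Subset using (Subset; inside; outside; _∈_; _∉_; ⁅_⁆; _∪_; _─_; _-_; ⊤; Nonempty; ∣_∣)
open import Data.Fin.Subset.Properties using (_∈?_; nonempty?; ∈⊤; ∉⊥; x∈⁅x⁆; x∈⁅y⁆⇒x≡y; ⊆-antisym; x∈p∪q⁻; x∈p∪q⁺; p─q⊆p; x∈p∧x≢y⇒x∈p-y; p─x─y≡p─y─x; x∈p⇒∣p-x∣<∣p∣)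
open import Data.List using (List; []; _∷_; map; allFin; filter)
open import Data.List.Membership.Propositional using (find; lose) renaming (_∈_ to _∈ₗ_; _∉_ to _∉ₗ_)
open import Data.List.Membership.Propositional.Properties using (∈-++⁺ˡ; ∈-++⁺ʳ; ∈-++⁻; ∈-filter⁺; ∈-filter⁻; ∈-allFin)
open import Data.List.Relation.Unary.All as All using (All; []; _∷_)
open import Data.List.Relation.Unary.AllPairs using (AllPairs; []; _∷_)
open import Data.List.Relation.Unary.AllPairs.Properties using () renaming (filter⁺ to AllPairs-filter⁺)
open import Data.List.Relation.Unary.Any as Any using (Any; here; there)
open import Data.List.Relation.Unary.Unique.Propositional using (Unique)
open import Data.List.Relation.Unary.Unique.Propositional.Properties using (allFin⁺)
open import Data.Product using (Σ; _×_; ∃; _,_; proj₁; proj₂)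
open import Data.Sum as Sum using (_⊎_; inj₁; inj₂; [_,_])
open import Data.Empty using (⊥; ⊥-elim)
open import Data.Unit using (tt)
open import Data.Vec.Base using (_∷_; there)
open import Function using (_∘_; id)
open import Function.Bundles using (Inverse; Equivalence)
open import Relation.Binary using (Tri; tri<; tri≈; tri>)
open import Relation.Binary.PropositionalEquality using (_≡_; _≢_; refl; sym; trans; cong; cong₂; subst)
open import Relation.Nullary using (¬_; Dec; yes; no; ¬?; _×-dec_; _⊎-dec_; contradiction)
open import Relation.Nullary.Decidable using (map′)
open import Relation.Unary.Properties using (∁?)

-- Finite sums and indicator functions.

sum-mono-All : ∀ {A : Set} {f g : A → ℕ} {xs} → All (λ x → f x ≤ g x) xs → sum (map f xs) ≤ sum (map g xs)
sum-mono-All []         = z≤n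
sum-mono-All (le ∷ les) = +-mono-≤ le (sum-mono-All les)

sum-mono : ∀ {A : Set} {f g : A → ℕ} xs → (∀ x → f x ≤ g x) → sum (map f xs) ≤ sum (map g xs)
sum-mono xs le = sum-mono-All (All.universal le xs)

sum-strict : ∀ {A : Set} {f g : A → ℕ} {x₀ xs} → x₀ ∈ₗ xs → (∀ x → f x ≤ g x) → f x₀ < g x₀ → sum (map f xs) < sum (map g xs)
sum-strict {xs = _ ∷ xs} (here refl) le lt = +-mono-<-≤ lt (sum-mono xs le)
sum-strict {xs = x ∷ _}  (there x₀∈) le lt = +-mono-≤-< (le x) (sum-strict x₀∈ le lt)

sum-zero : ∀ {A : Set} {f : A → ℕ} xs → (∀ x → f x ≡ 0) → sum (map f xs) ≡ 0
sum-zero []       f≡0 = refl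
sum-zero (x ∷ xs) f≡0 = cong₂ _+_ (f≡0 x) (sum-zero xs f≡0)

-- Uniqueness of the list ensures that the exceptional index `x₀` contributes its extra unit at most
-- once.
sum-bump : ∀ {n} {f g : Fin n → ℕ} x₀ {xs} → Unique xs → (∀ x → x ≢ x₀ → f x ≤ g x) → f x₀ ≤ suc (g x₀) → sum (map f xs) ≤ suc (sum (map g xs))
sum-bump x₀ [] le bump = z≤n
sum-bump x₀ {x ∷ _} (x∉ ∷ uniq) le bump with x ≟ x₀
... | yes refl = +-mono-≤ bump (sum-mono-All (All.map (λ x≢y → le _ (x≢y ∘ sym)) x∉))
... | no x≢x₀  = ≤-trans (+-mono-≤ (le x x≢x₀) (sum-bump x₀ uniq le bump)) (≤-reflexive (+-suc _ _))

-- Nested exactly as in `edges`, so that `edges G` unfolds to a `Σ₂` and can be compared termwise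
-- with the counts below.
Σ₂ : ∀ {n} → (Fin n → Fin n → ℕ) → ℕ
Σ₂ {n} f = sum (map (λ i → sum (map (λ j → f i j) (allFin n))) (allFin n))

Σ₂-mono : ∀ {n} {f g : Fin n → Fin n → ℕ} → (∀ i j → f i j ≤ g i j) → Σ₂ f ≤ Σ₂ g
Σ₂-mono {n} le = sum-mono (allFin n) (λ i → sum-mono (allFin n) (le i))

Σ₂-strict : ∀ {n} {f g : Fin n → Fin n → ℕ} i₀ j₀ → (∀ i j → f i j ≤ g i j) → f i₀ j₀ < g i₀ j₀ → Σ₂ f < Σ₂ g
Σ₂-strict {n} i₀ j₀ le lt = sum-strict (∈-allFin i₀) (λ i → sum-mono (allFin n) (le i)) (sum-strict (∈-allFin j₀) (le i₀) lt)

Σ₂-zero : ∀ {n} {f : Fin n → Fin n → ℕ} → (∀ i j → f i j ≡ 0) → Σ₂ f ≡ 0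
Σ₂-zero {n} f≡0 = sum-zero (allFin n) (λ i → sum-zero (allFin n) (f≡0 i))

Σ₂-bump : ∀ {n} {f g : Fin n → Fin n → ℕ} i₀ j₀ → (∀ i j → ¬ (i ≡ i₀ × j ≡ j₀) → f i j ≤ g i j) → f i₀ j₀ ≤ suc (g i₀ j₀) → Σ₂ f ≤ suc (Σ₂ g)
Σ₂-bump {n} i₀ j₀ le bump =
  sum-bump i₀ (allFin⁺ n)
    (λ i i≢i₀ → sum-mono (allFin n) (λ j → le i j (i≢i₀ ∘ proj₁)))
    (sum-bump j₀ (allFin⁺ n) (λ j j≢j₀ → le i₀ j (j≢j₀ ∘ proj₂)) bump)

ind : ∀ {P : Set} → Dec P → ℕ
ind (yes _) = 1
ind (no _)  = 0

ind-mono : ∀ {P Q : Set} (p : Dec P) (q : Dec Q) → (P → Q) → ind p ≤ ind q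
ind-mono (yes p) (yes q) f = ≤-refl
ind-mono (yes p) (no ¬q) f = contradiction (f p) ¬q
ind-mono (no ¬p) q       f = z≤n

ind-strict : ∀ {P Q : Set} (p : Dec P) (q : Dec Q) → ¬ P → Q → ind p < ind q
ind-strict (yes p) q       ¬p qq = contradiction p ¬p
ind-strict (no _)  (yes _) ¬p qq = ≤-refl
ind-strict (no _)  (no ¬q) ¬p qq = contradiction qq ¬q

ind≤1 : ∀ {P : Set} (p : Dec P) → ind p ≤ 1
ind≤1 (yes _) = ≤-refl
ind≤1 (no _)  = z≤n

ind-no : ∀ {P : Set} (p : Dec P) → ¬ P → ind p ≡ 0
ind-no (yes p) ¬p = contradiction p ¬p
ind-no (no _)  ¬p = refl

ind-yes : ∀ {P : Set} (p : Dec P) → P → ind p ≡ 1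
ind-yes (yes _) p = refl
ind-yes (no ¬p) p = contradiction p ¬p

-- Subsets, trees, tubes and paths.

x∈p─q⇒x∉q : ∀ {n} {x : Fin n} (p q : Subset n) → x ∈ p ─ q → x ∉ q
x∈p─q⇒x∉q (_ ∷ p) (outside ∷ q) (there x∈) (there x∈q) = x∈p─q⇒x∉q p q x∈ x∈q
x∈p─q⇒x∉q (_ ∷ p) (inside ∷ q)  (there x∈) (there x∈q) = x∈p─q⇒x∉q p q x∈ x∈q


x∈p-y⇒x∈p : ∀ {n} {p : Subset n} {x y} → x ∈ p - y → x ∈ p
x∈p-y⇒x∈p {p = p} = p─q⊆p p _

x∈p-y⇒x≢y : ∀ {n} {p : Subset n} {x y} → x ∈ p - y → x ≢ y
x∈p-y⇒x≢y {p = p} {y = y} x∈ refl = x∈p─q⇒x∉q p ⁅ y ⁆ x∈ (x∈⁅x⁆ y)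

argmin : ∀ {n} (p : Fin n → ℕ) {S : Subset n} {v} → v ∈ S → ∃ λ r → r ∈ S × (∀ u → u ∈ S → p r ≤ p u)
argmin {n} p {S} v∈S = go v∈S (<-wellFounded _)
  where
  go : ∀ {v} → v ∈ S → Acc _<_ (p v) → ∃ λ r → r ∈ S × (∀ u → u ∈ S → p r ≤ p u)
  go {v} v∈S (acc rs) with any? (λ u → (u ∈? S) ×-dec (p u <? p v))
  ... | yes (u , u∈S , lt) = go u∈S (rs lt)
  ... | no none            = v , v∈S , λ u u∈S → ≮⇒≥ (λ lt → none (u , u∈S , lt))

-- The mutual recursion through the list of children is carried out once here; later inductions find
-- their hypotheses in an `All`.
tree-ind : ∀ {n} {P : Tree n → Set} → (∀ r ts → All P ts → P (node r ts)) → ∀ t → P t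
tree-ind {n} {P} f = go
  where
  go  : ∀ t → P t
  goL : ∀ ts → All P ts
  go (node r ts) = f r ts (goL ts)
  goL []       = []
  goL (t ∷ ts) = go t ∷ goL ts

∈vertsL⁺ : ∀ {n} {ts : List (Tree n)} {t v} → t ∈ₗ ts → v ∈ verts t → v ∈ vertsL ts
∈vertsL⁺ (here refl) v∈ = x∈p∪q⁺ (inj₁ v∈)
∈vertsL⁺ (there t∈)  v∈ = x∈p∪q⁺ (inj₂ (∈vertsL⁺ t∈ v∈))

∈vertsL⁻ : ∀ {n} (ts : List (Tree n)) {v} → v ∈ vertsL ts → ∃ λ t → t ∈ₗ ts × v ∈ verts t
∈vertsL⁻ []       v∈ = contradiction v∈ ∉⊥
∈vertsL⁻ (t ∷ ts) v∈ with x∈p∪q⁻ (verts t) (vertsL ts) v∈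
... | inj₁ v∈t  = t , here refl , v∈t
... | inj₂ v∈ts = let u , u∈ , v∈u = ∈vertsL⁻ ts v∈ts in u , there u∈ , v∈u

∈tubesL⁺ : ∀ {n} {ts : List (Tree n)} {t Z} → t ∈ₗ ts → Z ∈ₗ tubes t → Z ∈ₗ tubesL ts
∈tubesL⁺ (here refl)              Z∈ = ∈-++⁺ˡ Z∈
∈tubesL⁺ {ts = u ∷ _} (there t∈)  Z∈ = ∈-++⁺ʳ (tubes u) (∈tubesL⁺ t∈ Z∈)

∈tubesL⁻ : ∀ {n} (ts : List (Tree n)) {Z} → Z ∈ₗ tubesL ts → ∃ λ t → t ∈ₗ ts × Z ∈ₗ tubes t
∈tubesL⁻ (t ∷ ts) Z∈ with ∈-++⁻ (tubes t) Z∈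
... | inj₁ Z∈t  = t , here refl , Z∈t
... | inj₂ Z∈ts = let u , u∈ , Z∈u = ∈tubesL⁻ ts Z∈ts in u , there u∈ , Z∈u

tubes-singleton⁻ : ∀ {n} (t : Tree n) {Z} → Z ∈ₗ tubesL (t ∷ []) → Z ∈ₗ tubes t
tubes-singleton⁻ t Z∈ with _ , here refl , Z∈t ← ∈tubesL⁻ (t ∷ []) Z∈ = Z∈t

root∈verts : ∀ {n} {r : Fin n} {ts} → r ∈ verts (node r ts)
root∈verts {r = r} = x∈p∪q⁺ (inj₁ (x∈⁅x⁆ r))

child⊆verts : ∀ {n} {r : Fin n} {ts t v} → t ∈ₗ ts → v ∈ verts t → v ∈ verts (node r ts)
child⊆verts t∈ v∈ = x∈p∪q⁺ (inj₂ (∈vertsL⁺ t∈ v∈))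

∈verts⁻ : ∀ {n} (r : Fin n) ts {v} → v ∈ verts (node r ts) → v ≡ r ⊎ v ∈ vertsL ts
∈verts⁻ r ts v∈ = Sum.map₁ (x∈⁅y⁆⇒x≡y r) (x∈p∪q⁻ ⁅ r ⁆ (vertsL ts) v∈)

verts∈tubes : ∀ {n} (t : Tree n) → verts t ∈ₗ tubes t
verts∈tubes (node r ts) = here refl

tube⊆verts : ∀ {n} (t : Tree n) {Z v} → Z ∈ₗ tubes t → v ∈ Z → v ∈ verts t
tube⊆verts = tree-ind λ where
  r ts ih (here refl) v∈ → v∈
  r ts ih (there Z∈)  v∈ → let t , t∈ , Z∈t = ∈tubesL⁻ ts Z∈ in child⊆verts t∈ (All.lookup ih t∈ Z∈t v∈)

tube⊆vertsL : ∀ {n} (ts : List (Tree n)) {Z v} → Z ∈ₗ tubesL ts → v ∈ Z → v ∈ vertsL ts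
tube⊆vertsL ts Z∈ v∈ = let t , t∈ , Z∈t = ∈tubesL⁻ ts Z∈ in ∈vertsL⁺ t∈ (tube⊆verts t Z∈t v∈)

tube-nonempty : ∀ {n} (t : Tree n) {Z} → Z ∈ₗ tubes t → Nonempty Z
tube-nonempty = tree-ind λ where
  r ts ih (here refl) → r , root∈verts {ts = ts}
  r ts ih (there Z∈)  → let t , t∈ , Z∈t = ∈tubesL⁻ ts Z∈ in All.lookup ih t∈ Z∈t

Path-weaken : ∀ {n} {G : Adj n} {S S′ u v} → (∀ {x} → x ∈ S → x ∈ S′) → Path G S u v → Path G S′ u v
Path-weaken S⊆ (here u∈)     = here (S⊆ u∈)
Path-weaken S⊆ (step u∈ e π) = step (S⊆ u∈) e (Path-weaken S⊆ π)

Path-++ : ∀ {n} {G : Adj n} {S u v w} → Path G S u v → Path G S v w → Path G S u w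
Path-++ (here _)      ρ = ρ
Path-++ (step u∈ e π) ρ = step u∈ e (Path-++ π ρ)

Path-source : ∀ {n} {G : Adj n} {S u v} → Path G S u v → u ∈ S
Path-source (here u∈)     = u∈
Path-source (step u∈ _ _) = u∈

-- Below P u v: when P is the set of tubes of a search tree, u is not an ancestor of v
-- (nor v itself); for adjacent u and v this means that u is a descendant of v.
Below : ∀ {n} → (Subset n → Set) → Fin n → Fin n → Set
Below P u v = ∃ λ Z → P Z × u ∈ Z × v ∉ Z

below? : ∀ {n} (L : List (Subset n)) u v → Dec (Below (_∈ₗ L) u v)
below? L u v = map′ find (λ (Z , Z∈ , uv) → lose Z∈ uv) (Any.any? (λ Z → (u ∈? Z) ×-dec ¬? (v ∈? Z)) L)

-- Search forests, components and the ancestor relation.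

DisjointTrees : ∀ {n} → Tree n → Tree n → Set
DisjointTrees t u = Disjoint (verts t) (verts u)

disjoint-children-unique : ∀ {n} {ts : List (Tree n)} {t u v} → AllPairs DisjointTrees ts →
  t ∈ₗ ts → u ∈ₗ ts → v ∈ verts t → v ∈ verts u → t ≡ u
disjoint-children-unique (_ ∷ _)  (here refl) (here refl) _ _ = refl
disjoint-children-unique (d ∷ _)  (here refl) (there u∈) v∈t v∈u = contradiction v∈u (All.lookup d u∈ _ v∈t)
disjoint-children-unique (d ∷ _)  (there t∈) (here refl) v∈t v∈u = contradiction v∈t (All.lookup d t∈ _ v∈u)
disjoint-children-unique (_ ∷ ds) (there t∈) (there u∈) v∈t v∈u = disjoint-children-unique ds t∈ u∈ v∈t v∈u

-- Tubes are nonempty, so a shared tube would give a shared vertex.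
disjoint-tubes : ∀ {n} {t : Tree n} {ts} → All (DisjointTrees t) ts → ∀ Z → Z ∈ₗ tubes t → ¬ Z ∈ₗ tubesL ts
disjoint-tubes {t = t} {ts} disj Z Z∈t Z∈ts =
  let x , x∈ = tube-nonempty t Z∈t ; u , u∈ , Z∈u = ∈tubesL⁻ ts Z∈ts
  in All.lookup disj u∈ x (tube⊆verts t Z∈t x∈) (tube⊆verts u Z∈u x∈)

-- These are the clauses of `IsSearchTree` below the root, for an arbitrary set in place of `S - r`.
-- A search tree on `S` with root `r` is thus, definitionally, a proof of `r ∈ S` paired with a
-- `Forest` on `S - r`.
Forest : ∀ {n} → Adj n → Subset n → List (Tree n) → Set
Forest G S ts = ChildrenOK G S ts × AllPairs DisjointTrees ts × (∀ v → v ∈ S → Any (λ t → v ∈ verts t) ts)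

ChildOK : ∀ {n} → Adj n → Subset n → Tree n → Set
ChildOK G S t = IsComponent G S (verts t) × IsSearchTree G (verts t) t

childrenOK⁺ : ∀ {n} {G : Adj n} {S ts} → (∀ {t} → t ∈ₗ ts → ChildOK G S t) → ChildrenOK G S ts
childrenOK⁺ {ts = []}    ok = tt
childrenOK⁺ {ts = _ ∷ _} ok = ok (here refl) , childrenOK⁺ (ok ∘ there)

childOK : ∀ {n} {G : Adj n} {S ts t} → ChildrenOK G S ts → t ∈ₗ ts → ChildOK G S t
childOK (ok , _)  (here refl) = ok
childOK (_ , oks) (there t∈)  = childOK oks t∈

component-closed : ∀ {n} {G : Adj n} {S C C′ u v} → IsComponent G S C → (∀ {x} → x ∈ C′ → x ∈ S) →
  Path G C′ u v → u ∈ C → v ∈ C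
component-closed C-comp C′⊆S (here _) u∈ = u∈
component-closed C-comp@(_ , _ , _ , closed) C′⊆S (step _ e π) u∈ =
  component-closed C-comp C′⊆S π (closed _ _ u∈ (C′⊆S (Path-source π)) e)

component-unique : ∀ {n} {G : Adj n} {S C C′ x} → IsComponent G S C → IsComponent G S C′ → x ∈ C → x ∈ C′ → C ≡ C′
component-unique c@(C⊆ , _ , conn , _) c′@(C′⊆ , _ , conn′ , _) x∈ x∈′ = ⊆-antisym
  (λ v∈ → component-closed c′ C⊆ (conn _ _ x∈ v∈) x∈′)
  (λ v∈ → component-closed c C′⊆ (conn′ _ _ x∈′ v∈) x∈)

verts≡ : ∀ {n} {G : Adj n} {S} t → IsSearchTree G S t → verts t ≡ S
verts≡ {S = S} (node r ts) (r∈ , ok , _ , cover) = ⊆-antisym to from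
  where
  to : ∀ {v} → v ∈ verts (node r ts) → v ∈ S
  to v∈ with ∈verts⁻ r ts v∈
  ... | inj₁ refl = r∈
  ... | inj₂ v∈ts = let t , t∈ , v∈t = ∈vertsL⁻ ts v∈ts in x∈p-y⇒x∈p (proj₁ (proj₁ (childOK ok t∈)) v∈t)
  from : ∀ {v} → v ∈ S → v ∈ verts (node r ts)
  from {v} v∈ with v ≟ r
  ... | yes refl = root∈verts {ts = ts}
  ... | no v≢r   = let t , t∈ , v∈t = find (cover v (x∈p∧x≢y⇒x∈p-y v∈ v≢r)) in child⊆verts t∈ v∈t

vertsL⊆ : ∀ {n} {G : Adj n} {S} ts → ChildrenOK G S ts → ∀ {v} → v ∈ vertsL ts → v ∈ S
vertsL⊆ ts ok v∈ = let t , t∈ , v∈t = ∈vertsL⁻ ts v∈ in proj₁ (proj₁ (childOK ok t∈)) v∈t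

-- The root tube contains both vertices, so both witnesses lie in child subtrees. Children span
-- components, hence the edge forces both witnesses into the same child, and induction applies.
-- Nonadjacent vertices in different branches would satisfy both relations.
below-exclusive : ∀ {n} {G : Adj n} t {S u v} → IsSearchTree G S t → G u v ≡ true →
  Below (_∈ₗ tubes t) u v → Below (_∈ₗ tubes t) v u → ⊥
below-exclusive = tree-ind λ where
  r ts ih st e (_ , here refl , u∈Z , v∉Z) (_ , Z′∈ , v∈Z′ , _) → v∉Z (tube⊆verts (node r ts) Z′∈ v∈Z′)
  r ts ih st e (_ , Z∈ , u∈Z , _) (_ , here refl , _ , u∉Z′)    → u∉Z′ (tube⊆verts (node r ts) Z∈ u∈Z)
  r ts ih (_ , ok , disj , _) e (Z , there Z∈ , u∈Z , v∉Z) (Z′ , there Z′∈ , v∈Z′ , u∉Z′) →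
    let t  , t∈  , Z∈t   = ∈tubesL⁻ ts Z∈
        t′ , t′∈ , Z′∈t′ = ∈tubesL⁻ ts Z′∈
        (_ , _ , _ , closed) , st = childOK ok t∈
        v∈t′ = tube⊆verts t′ Z′∈t′ v∈Z′
        v∈t  = closed _ _ (tube⊆verts t Z∈t u∈Z) (proj₁ (proj₁ (childOK ok t′∈)) v∈t′) e
        t′≡t = disjoint-children-unique disj t′∈ t∈ v∈t′ v∈t
    in All.lookup ih t∈ st e (Z , Z∈t , u∈Z , v∉Z) (Z′ , subst (λ s → Z′ ∈ₗ tubes s) t′≡t Z′∈t′ , v∈Z′ , u∉Z′)

-- If `u` is the root, the child containing `v` separates them. Otherwise the child containing `u`
-- either misses `v` or contains both, and then induction applies.
below-total : ∀ {n} {G : Adj n} t {S u v} → IsSearchTree G S t → u ∈ S → v ∈ S → u ≢ v →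
  Below (_∈ₗ tubes t) u v ⊎ Below (_∈ₗ tubes t) v u
below-total {G = G} = tree-ind go
  where
  P = λ t → ∀ {S u v} → IsSearchTree G S t → u ∈ S → v ∈ S → u ≢ v →
    Below (_∈ₗ tubes t) u v ⊎ Below (_∈ₗ tubes t) v u
  go : ∀ r ts → All P ts → P (node r ts)
  go r ts ih {S} {u} {v} (_ , ok , _ , cover) u∈ v∈ u≢v with u ≟ r
  ... | yes refl =
    let t , t∈ , v∈t = find (cover v (x∈p∧x≢y⇒x∈p-y v∈ (u≢v ∘ sym)))
    in inj₂ (verts t , there (∈tubesL⁺ t∈ (verts∈tubes t)) , v∈t ,
             λ r∈t → x∈p-y⇒x≢y {p = S} (proj₁ (proj₁ (childOK ok t∈)) r∈t) refl)
  ... | no u≢r with find (cover u (x∈p∧x≢y⇒x∈p-y u∈ u≢r))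
  ... | t , t∈ , u∈t with v ∈? verts t
  ... | no v∉t  = inj₁ (verts t , there (∈tubesL⁺ t∈ (verts∈tubes t)) , u∈t , v∉t)
  ... | yes v∈t = Sum.map lift lift (All.lookup ih t∈ (proj₂ (childOK ok t∈)) u∈t v∈t u≢v)
    where
    lift : ∀ {x y} → Below (_∈ₗ tubes t) x y → Below (_∈ₗ tubes (node r ts)) x y
    lift (Z , Z∈ , xy) = Z , there (∈tubesL⁺ t∈ Z∈) , xy

-- Here `r` is the root of the subtree spanning `Z`, and `Z′` is the child tube below it that holds
-- `v`. The subtree stays hidden, so that rotations can be studied through tubes alone.
tube-root : ∀ {n} {G : Adj n} t {S Z} → IsSearchTree G S t → Z ∈ₗ tubes t →
  ∃ λ r → r ∈ Z × (∀ v → v ∈ Z → v ≢ r →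
    ∃ λ Z′ → Z′ ∈ₗ tubes t × v ∈ Z′ × r ∉ Z′ × (∀ {x} → x ∈ Z′ → x ∈ Z))
tube-root {G = G} = tree-ind go
  where
  P = λ t → ∀ {S Z} → IsSearchTree G S t → Z ∈ₗ tubes t →
    ∃ λ r → r ∈ Z × (∀ v → v ∈ Z → v ≢ r →
      ∃ λ Z′ → Z′ ∈ₗ tubes t × v ∈ Z′ × r ∉ Z′ × (∀ {x} → x ∈ Z′ → x ∈ Z))
  go : ∀ r ts → All P ts → P (node r ts)
  go r ts ih {S} (_ , ok , _) (here refl) = r , root∈verts {ts = ts} , λ v v∈ v≢r →
    let t , t∈ , v∈t = ∈vertsL⁻ ts ([ (λ v≡r → contradiction v≡r v≢r) , id ] (∈verts⁻ r ts v∈))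
    in verts t , there (∈tubesL⁺ t∈ (verts∈tubes t)) , v∈t ,
       (λ r∈t → x∈p-y⇒x≢y {p = S} (proj₁ (proj₁ (childOK ok t∈)) r∈t) refl) , child⊆verts t∈
  go r ts ih (_ , ok , _) (there Z∈) =
    let t , t∈ , Z∈t  = ∈tubesL⁻ ts Z∈
        s , s∈ , down = All.lookup ih t∈ (proj₂ (childOK ok t∈)) Z∈t
    in s , s∈ , λ v v∈ v≢s → let Z′ , Z′∈ , rest = down v v∈ v≢s in Z′ , there (∈tubesL⁺ t∈ Z′∈) , rest

-- Edge orientations under rotation.

EdgeAt : ∀ {n} → Adj n → Fin n → Fin n → Set
EdgeAt G i j = G i j ≡ true × toℕ i < toℕ j

edgeTerm≤ind : ∀ {n} {G : Adj n} {P : Set} (p : Dec P) i j → (EdgeAt G i j → P) →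
  (if G i j ∧ (toℕ i <ᵇ toℕ j) then 1 else 0) ≤ ind p
edgeTerm≤ind {G = G} p i j f with G i j ∧ (toℕ i <ᵇ toℕ j) in eq
... | false = z≤n
... | true  = ≤-reflexive (sym (ind-yes p (f (Equivalence.to T-≡ (proj₁ both) , <ᵇ⇒< _ _ (proj₂ both)))))
  where
  both : T (G i j) × T (toℕ i <ᵇ toℕ j)
  both = Equivalence.to T-∧ (Equivalence.from T-≡ eq)

ind≤edgeTerm : ∀ {n} {G : Adj n} {P : Set} (p : Dec P) i j → (P → EdgeAt G i j) →
  ind p ≤ (if G i j ∧ (toℕ i <ᵇ toℕ j) then 1 else 0)
ind≤edgeTerm (no _) i j f = z≤n
ind≤edgeTerm (yes p) i j f with f p
... | e , i<j rewrite e | Equivalence.to T-≡ (<⇒<ᵇ i<j) = ≤-refl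

-- Only the edge joining the roots of the two exchanged tubes (if it is one) can be reoriented.
rotation-flip : ∀ {n} {G : Adj n} (T U : SearchTree G) → Rotation {G = G} T U →
  ∃ λ i₀ → ∃ λ j₀ → ∀ i j → G i j ≡ true → Below (_∈ₗ tubes (proj₁ T)) j i → ¬ (i ≡ i₀ × j ≡ j₀) →
    Below (_∈ₗ tubes (proj₁ U)) j i
rotation-flip {G = G} (t , T-ok) (u , U-ok) (X , Y , X∈t , X∉u , Y∈u , Y∉t , onlyX , onlyY)
  with tube-root t T-ok X∈t | tube-root u U-ok Y∈u
... | x , x∈X , X-down | y , y∈Y , Y-down = y , x , kept
  where
  kept : ∀ i j → G i j ≡ true → Below (_∈ₗ tubes t) j i → ¬ (i ≡ y × j ≡ x) → Below (_∈ₗ tubes u) j i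
  kept i j e j↓i@(Z , Z∈t , j∈Z , i∉Z) ≢yx with below? (tubes u) j i
  ... | yes below = below
  ... | no ¬below with below-total u U-ok ∈⊤ ∈⊤ i≢j
    where
    i≢j : i ≢ j
    i≢j refl = i∉Z j∈Z
  ... | inj₂ below = below
  ... | inj₁ (Z′ , Z′∈u , i∈Z′ , j∉Z′) = contradiction (i≡y , j≡x) ≢yx
    where
    -- Such a tube cannot survive in `u`, where `j` is not below `i`; so it is the lost tube.
    from-t : ∀ W → W ∈ₗ tubes t → j ∈ W → i ∉ W → W ≡ X
    from-t W W∈t j∈W i∉W = onlyX W W∈t (λ W∈u → ¬below (W , W∈u , j∈W , i∉W))
    -- Such a tube cannot come from `t`, where the edge has the opposite orientation; so it is the
    -- gained tube.
    from-u : ∀ W → W ∈ₗ tubes u → i ∈ W → j ∉ W → W ≡ Y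
    from-u W W∈u i∈W j∉W = onlyY W W∈u (λ W∈t → below-exclusive t T-ok e (W , W∈t , i∈W , j∉W) j↓i)
    Z≡X : Z ≡ X
    Z≡X = from-t Z Z∈t j∈Z i∉Z
    Z′≡Y : Z′ ≡ Y
    Z′≡Y = from-u Z′ Z′∈u i∈Z′ j∉Z′
    -- Otherwise the child tube of `X` holding `j` also separates `j` from `i`, hence equals `X`,
    -- although it misses `x`. The argument for `i` and `y` is symmetric.
    j≡x : j ≡ x
    j≡x with j ≟ x
    ... | yes eq = eq
    ... | no j≢x =
      let W , W∈t , j∈W , x∉W , W⊆X = X-down j (subst (j ∈_) Z≡X j∈Z) j≢x
      in contradiction (subst (x ∈_) (sym (from-t W W∈t j∈W (λ i∈W → i∉Z (subst (i ∈_) (sym Z≡X) (W⊆X i∈W))))) x∈X) x∉W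
    i≡y : i ≡ y
    i≡y with i ≟ y
    ... | yes eq = eq
    ... | no i≢y =
      let W , W∈u , i∈W , y∉W , W⊆Y = Y-down i (subst (i ∈_) Z′≡Y i∈Z′) i≢y
      in contradiction (subst (y ∈_) (sym (from-u W W∈u i∈W (λ j∈W → j∉Z′ (subst (j ∈_) (sym Z′≡Y) (W⊆Y j∈W))))) y∈Y) y∉W

downEdge? : ∀ {n} (G : Adj n) L i j → Dec (EdgeAt G i j × Below (_∈ₗ L) j i)
downEdge? G L i j = ((G i j ≟ᵇ true) ×-dec (toℕ i <? toℕ j)) ×-dec below? L j i

downEdges : ∀ {n} {G : Adj n} → SearchTree G → ℕ
downEdges {G = G} T = Σ₂ (λ i j → ind (downEdge? G (tubes (proj₁ T)) i j))

-- By `rotation-flip`, all down edges but at most one survive each rotation, so the count drops by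
-- at most one per step.
rotations-downEdges : ∀ {n} {G : Adj n} {k} (T U : SearchTree G) →
  Rotations {G = G} k T U → downEdges {G = G} T ≤ k + downEdges {G = G} U
rotations-downEdges {G = G} T U (done same) = Σ₂-mono λ i j →
  ind-mono (downEdge? G _ i j) (downEdge? G _ i j) λ (e , Z , Z∈ , ji) → e , Z , proj₁ (same Z) Z∈ , ji
rotations-downEdges {G = G} T U (step {U = V} rot rots) with rotation-flip T V rot
... | i₀ , j₀ , kept = ≤-trans
  (Σ₂-bump i₀ j₀
    (λ i j ≢ → ind-mono (downEdge? G _ i j) (downEdge? G _ i j) λ (e , b) → e , kept i j (proj₁ e) b ≢)
    (≤-trans (ind≤1 (downEdge? G _ i₀ j₀)) (s≤s z≤n)))
  (s≤s (rotations-downEdges V U rots))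

-- Building search forests by grafting vertices.

module _ {n} {G : Adj n} (G-sym : ∀ i j → G i j ≡ G j i) where

  Path-sym : ∀ {S u v} → Path G S u v → Path G S v u
  Path-sym (here u∈)     = here u∈
  Path-sym (step u∈ e π) = Path-++ (Path-sym π) (step (Path-source π) (trans (G-sym _ _) e) (here u∈))

  Touches : Fin n → Tree n → Set
  Touches v t = ∃ λ w → w ∈ verts t × G v w ≡ true

  touches? : ∀ v t → Dec (Touches v t)
  touches? v t = any? (λ w → (w ∈? verts t) ×-dec (G v w ≟ᵇ true))

  touching : Fin n → List (Tree n) → List (Tree n)
  touching v = filter (touches? v)

  avoiding : Fin n → List (Tree n) → List (Tree n)
  avoiding v = filter (∁? (touches? v))

  -- Putting `v` back into the graph merges the components adjacent to it into one, which gets `v`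
  -- as its root; the other components stay. This serves both to build search trees and to perform
  -- rotations.
  graft : Fin n → List (Tree n) → List (Tree n)
  graft v ts = node v (touching v ts) ∷ avoiding v ts

  touching-or-avoiding : ∀ v {ts t} → t ∈ₗ ts → t ∈ₗ touching v ts ⊎ t ∈ₗ avoiding v ts
  touching-or-avoiding v {t = t} t∈ with touches? v t
  ... | yes touch = inj₁ (∈-filter⁺ (touches? v) t∈ touch)
  ... | no avoid  = inj₂ (∈-filter⁺ (∁? (touches? v)) t∈ avoid)

  -- Each touched component has an edge to `v`, so together with `v` they are connected. An
  -- untouched component gains no neighbour when `v` is added, so it stays closed in `S`.
  graft-forest : ∀ {S v ts} → v ∈ S → Forest G (S - v) ts → Forest G S (graft v ts)
  graft-forest {S} {v} {ts} v∈S (ok , disj , cover) =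
      (((Y⊆S , (v , v∈Y) , Y-connected , Y-closed) , (v∈Y , childrenOK⁺ touching-ok , AllPairs-filter⁺ (touches? v) disj , touching-cover)) , childrenOK⁺ avoiding-ok)
    , (All.tabulate Y-disjoint ∷ AllPairs-filter⁺ (∁? (touches? v)) disj)
    , graft-cover
    where
    us = touching v ts
    ws = avoiding v ts
    Y = verts (node v us)

    v∈Y : v ∈ Y
    v∈Y = root∈verts {ts = us}

    child : ∀ {t} → t ∈ₗ ts → ChildOK G (S - v) t
    child = childOK ok

    child⊆ : ∀ {t x} → t ∈ₗ ts → x ∈ verts t → x ∈ S - v
    child⊆ t∈ = proj₁ (proj₁ (child t∈))

    us⁻ : ∀ {t} → t ∈ₗ us → t ∈ₗ ts × Touches v t
    us⁻ = ∈-filter⁻ (touches? v)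

    ws⁻ : ∀ {t} → t ∈ₗ ws → t ∈ₗ ts × ¬ Touches v t
    ws⁻ = ∈-filter⁻ (∁? (touches? v))

    Y⁻ : ∀ {x} → x ∈ Y → x ≡ v ⊎ ∃ λ t → t ∈ₗ us × x ∈ verts t
    Y⁻ x∈ = Sum.map₂ (∈vertsL⁻ us) (∈verts⁻ v us x∈)

    Y⊆S : ∀ {x} → x ∈ Y → x ∈ S
    Y⊆S x∈ with Y⁻ x∈
    ... | inj₁ refl          = v∈S
    ... | inj₂ (t , t∈ , x∈t) = x∈p-y⇒x∈p (child⊆ (proj₁ (us⁻ t∈)) x∈t)

    to-v : ∀ {x} → x ∈ Y → Path G Y x v
    to-v x∈ with Y⁻ x∈
    ... | inj₁ refl = here v∈Y
    ... | inj₂ (t , t∈us , x∈t) with us⁻ t∈us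
    ... | t∈ , y , y∈t , e = Path-++
      (Path-weaken (child⊆verts t∈us) (proj₁ (proj₂ (proj₂ (proj₁ (child t∈)))) _ _ x∈t y∈t))
      (step (child⊆verts t∈us y∈t) (trans (G-sym _ _) e) (here v∈Y))

    Y-connected : ConnectedOn G Y
    Y-connected x y x∈ y∈ = Path-++ (to-v x∈) (Path-sym (to-v y∈))

    Y-closed : ∀ x w → x ∈ Y → w ∈ S → G x w ≡ true → w ∈ Y
    Y-closed x w x∈ w∈ e with w ≟ v
    ... | yes refl = v∈Y
    ... | no w≢v with Y⁻ x∈
    ...   | inj₂ (t , t∈us , x∈t) = child⊆verts t∈us
              (proj₂ (proj₂ (proj₂ (proj₁ (child (proj₁ (us⁻ t∈us)))))) x w x∈t (x∈p∧x≢y⇒x∈p-y w∈ w≢v) e)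
    ...   | inj₁ refl with find (cover w (x∈p∧x≢y⇒x∈p-y w∈ w≢v))
    ...     | t , t∈ , w∈t = child⊆verts (∈-filter⁺ (touches? v) t∈ (w , w∈t , e)) w∈t

    touching-ok : ∀ {t} → t ∈ₗ us → ChildOK G (Y - v) t
    touching-ok t∈us with us⁻ t∈us
    ... | t∈ , _ with child t∈
    ... | (C⊆ , ne , conn , closed) , st =
      ((λ x∈ → x∈p∧x≢y⇒x∈p-y (child⊆verts t∈us x∈) (x∈p-y⇒x≢y {p = S} (C⊆ x∈))) , ne , conn ,
       λ x w x∈ w∈ → closed x w x∈ (x∈p∧x≢y⇒x∈p-y (Y⊆S (x∈p-y⇒x∈p w∈)) (x∈p-y⇒x≢y {p = Y} w∈))) , st

    touching-cover : ∀ x → x ∈ Y - v → Any (λ t → x ∈ verts t) us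
    touching-cover x x∈ with Y⁻ (x∈p-y⇒x∈p x∈)
    ... | inj₁ x≡v            = contradiction x≡v (x∈p-y⇒x≢y {p = Y} x∈)
    ... | inj₂ (t , t∈ , x∈t) = lose t∈ x∈t

    avoiding-ok : ∀ {t} → t ∈ₗ ws → ChildOK G S t
    avoiding-ok {t} t∈ws with ws⁻ t∈ws
    ... | t∈ , avoid with child t∈
    ... | (C⊆ , ne , conn , closed) , st = ((λ x∈ → x∈p-y⇒x∈p (C⊆ x∈)) , ne , conn , closed′) , st
      where
      closed′ : ∀ x w → x ∈ verts t → w ∈ S → G x w ≡ true → w ∈ verts t
      closed′ x w x∈ w∈ e with w ≟ v
      ... | yes refl = contradiction (x , x∈ , trans (G-sym _ _) e) avoid
      ... | no w≢v   = closed x w x∈ (x∈p∧x≢y⇒x∈p-y w∈ w≢v) e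

    Y-disjoint : ∀ {t} → t ∈ₗ ws → DisjointTrees (node v us) t
    Y-disjoint t∈ws x x∈Y x∈t with ws⁻ t∈ws | Y⁻ x∈Y
    ... | t∈ , _     | inj₁ refl = x∈p-y⇒x≢y {p = S} (child⊆ t∈ x∈t) refl
    ... | t∈ , avoid | inj₂ (u , u∈us , x∈u) with us⁻ u∈us
    ...   | u∈ , touch with disjoint-children-unique disj u∈ t∈ x∈u x∈t
    ...     | refl = avoid touch

    graft-cover : ∀ x → x ∈ S → Any (λ t → x ∈ verts t) (graft v ts)
    graft-cover x x∈ with x ≟ v
    ... | yes refl = here v∈Y
    ... | no x≢v with find (cover x (x∈p∧x≢y⇒x∈p-y x∈ x≢v))
    ...   | t , t∈ , x∈t with touching-or-avoiding v t∈
    ...     | inj₁ t∈us = here (child⊆verts t∈us x∈t)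
    ...     | inj₂ t∈ws = there (lose t∈ws x∈t)

  graft-tubes⁺ : ∀ v ts {Z} → Z ∈ₗ tubesL ts → Z ∈ₗ tubesL (graft v ts)
  graft-tubes⁺ v ts Z∈ with ∈tubesL⁻ ts Z∈
  ... | t , t∈ , Z∈t with touching-or-avoiding v t∈
  ...   | inj₁ t∈us = ∈-++⁺ˡ (there (∈tubesL⁺ t∈us Z∈t))
  ...   | inj₂ t∈ws = ∈-++⁺ʳ (tubes (node v (touching v ts))) (∈tubesL⁺ t∈ws Z∈t)

  -- With `graft-tubes⁺` this says that grafting adds a single tube, the one rooted at `v`, and
  -- loses none. The exchange of tubes in `rotate-root` is computed from it.
  graft-tubes⁻ : ∀ v ts {Z} → Z ∈ₗ tubesL (graft v ts) → Z ≡ verts (node v (touching v ts)) ⊎ Z ∈ₗ tubesL ts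
  graft-tubes⁻ v ts Z∈ with ∈-++⁻ (tubes (node v (touching v ts))) Z∈
  ... | inj₁ (here eq) = inj₁ eq
  ... | inj₁ (there Z∈us) with ∈tubesL⁻ (touching v ts) Z∈us
  ...   | t , t∈us , Z∈t = inj₂ (∈tubesL⁺ (proj₁ (∈-filter⁻ (touches? v) {xs = ts} t∈us)) Z∈t)
  graft-tubes⁻ v ts Z∈ | inj₂ Z∈ws with ∈tubesL⁻ (avoiding v ts) Z∈ws
  ... | t , t∈ws , Z∈t = inj₂ (∈tubesL⁺ (proj₁ (∈-filter⁻ (∁? (touches? v)) {xs = ts} t∈ws)) Z∈t)

  -- Deleting the vertices of S in order of increasing p and searching recursively.
  ordered-forest : ∀ (p : Fin n → ℕ) S → Acc _<_ ∣ S ∣ → ∃ λ ts → Forest G S ts ×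
    (∀ i j → i ∈ S → j ∈ S → G i j ≡ true → p i < p j → Below (_∈ₗ tubesL ts) j i)
  ordered-forest p S (acc rs) with nonempty? S
  ... | no empty = [] , (tt , [] , λ v v∈ → contradiction (v , v∈) empty) , λ i j i∈ → contradiction (i , i∈) empty
  ... | yes (_ , s∈) with argmin p s∈
  ... | r , r∈ , r-min with ordered-forest p (S - r) (rs (x∈p⇒∣p-x∣<∣p∣ r∈))
  ... | ts , forest@(ok , _ , cover) , below = graft r ts , graft-forest r∈ forest , below′
    where
    below′ : ∀ i j → i ∈ S → j ∈ S → G i j ≡ true → p i < p j → Below (_∈ₗ tubesL (graft r ts)) j i
    below′ i j i∈ j∈ e lt with j ≟ r
    ... | yes refl = contradiction (r-min i i∈) (<⇒≱ lt)
    ... | no j≢r with i ≟ r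
    ...   | no i≢r = let Z , Z∈ , ji = below i j (x∈p∧x≢y⇒x∈p-y i∈ i≢r) (x∈p∧x≢y⇒x∈p-y j∈ j≢r) e lt
                     in Z , graft-tubes⁺ r ts Z∈ , ji
    ...   | yes refl with find (cover j (x∈p∧x≢y⇒x∈p-y j∈ j≢r))
    ...     | t , t∈ , j∈t = verts t , graft-tubes⁺ r ts (∈tubesL⁺ t∈ (verts∈tubes t)) , j∈t ,
                             λ r∈t → x∈p-y⇒x≢y {p = S} (proj₁ (proj₁ (childOK ok t∈)) r∈t) refl

  -- Connectivity makes every component of `⊤` equal to `⊤`, so the forest consists of one tree; the
  -- vertex `v` rules out the empty forest.
  ordered-search-tree : Connected G → Fin n → ∀ (p : Fin n → ℕ) → Σ (SearchTree G) λ T →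
    ∀ i j → G i j ≡ true → p i < p j → Below (_∈ₗ tubes (proj₁ T)) j i
  ordered-search-tree conn v p with ordered-forest p ⊤ (<-wellFounded _)
  ... | [] , (_ , _ , cover) , _ with () ← cover v ∈⊤
  ... | t ∷ [] , (((comp , st) , _) , _) , below =
    (t , subst (λ S → IsSearchTree G S t) (⊆-antisym (λ _ → ∈⊤) ⊤⊆t) st) , λ i j e lt →
      let Z , Z∈ , ji = below i j ∈⊤ ∈⊤ e lt in Z , tubes-singleton⁻ t Z∈ , ji
    where
    ⊤⊆t : ∀ {x} → x ∈ ⊤ → x ∈ verts t
    ⊤⊆t x∈ = let y , y∈ = proj₁ (proj₂ comp) in component-closed comp id (conn y _ ∈⊤ x∈) y∈
  ... | t ∷ t′ ∷ _ , (((comp , _) , (comp′ , _) , _) , (disj ∷ _) , _) , _ =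
    let y , y∈ = proj₁ (proj₂ comp) ; y′ , y′∈ = proj₁ (proj₂ comp′)
    in ⊥-elim (All.head disj y′ (component-closed comp id (conn y y′ ∈⊤ ∈⊤) y∈) y′∈)

-- The lower bound.

diameter-lower : ∀ {n} (G : Adj n) → (∀ i j → G i j ≡ G j i) → Connected G → Fin n →
  Σ (SearchTree G) λ T → Σ (SearchTree G) λ T′ → ∀ k → Rotations {G = G} k T T′ → edges G ≤ k
diameter-lower {n} G G-sym conn v =
  let T  , T-below  = ordered-search-tree G-sym conn v toℕ
      -- `n ∸ toℕ i` reverses the order of the vertices: all edges are down edges in `T` and none is
      -- in `T′`.
      T′ , T′-below = ordered-search-tree G-sym conn v (λ i → n ∸ toℕ i)
  in T , T′ , λ k rots → ≤-trans
    (Σ₂-mono λ i j → edgeTerm≤ind {G = G} (downEdge? G _ i j) i j λ e → e , T-below i j (proj₁ e) (proj₂ e))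
    (≤-trans (rotations-downEdges T T′ rots) (≤-reflexive (trans
      (cong (k +_) (Σ₂-zero λ i j → ind-no (downEdge? G _ i j) λ ((e , i<j) , b) →
        below-exclusive (proj₁ T′) (proj₂ T′) e
          (T′-below j i (trans (G-sym j i) e) (∸-monoʳ-< i<j (<⇒≤ (toℕ<n j)))) b))
      (+-identityʳ k))))

-- A trivially perfect graph is the comparability graph of a rooted forest, and p plays the
-- role of the depth in it: along an edge, the shallower endpoint dominates the deeper one.
IsDepth : ∀ {n} → Adj n → (Fin n → ℕ) → Set
IsDepth G p = ∀ u v → G u v ≡ true →
  p u ≢ p v × (p u < p v → ∀ w → G v w ≡ true → w ≡ u ⊎ G u w ≡ true)

-- Depth functions of trivially perfect graphs.

splitAt-injective : ∀ a {b} {i j : Fin (a + b)} → splitAt a i ≡ splitAt a j → i ≡ j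
splitAt-injective a {b} {i} {j} eq with splitAt a i in eqᵢ
... | inj₁ x = trans (sym (splitAt⁻¹-↑ˡ eqᵢ)) (splitAt⁻¹-↑ˡ (sym eq))
... | inj₂ y = trans (sym (splitAt⁻¹-↑ʳ {m = a} eqᵢ)) (splitAt⁻¹-↑ʳ {m = a} (sym eq))

cone-depth : ∀ {n} {G : Adj n} {p} → IsDepth G p → ∃ (IsDepth (cone G))
cone-depth {G = G} {p} depth = p′ , depth′
  where
  p′ : Fin _ → ℕ
  p′ zero    = 0
  p′ (suc i) = suc (p i)
  depth′ : IsDepth (cone G) p′
  depth′ zero    (suc v) _ = (λ ()) , λ where
    _ zero    _ → inj₁ refl
    _ (suc w) _ → inj₂ refl
  depth′ (suc u) zero    _ = (λ ()) , λ ()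
  depth′ (suc u) (suc v) e = proj₁ (depth u v e) ∘ suc-injective , λ where
    _        zero    _  → inj₂ refl
    (s≤s lt) (suc w) e′ → Sum.map₁ (cong suc) (proj₂ (depth u v e) lt w e′)

-- `disjointUnion` after `splitAt` has been applied, so that cases can be split by pattern matching
-- on the summands.
sumAdj : ∀ {a b} → Adj a → Adj b → Fin a ⊎ Fin b → Fin a ⊎ Fin b → Bool
sumAdj G H (inj₁ x) (inj₁ y) = G x y
sumAdj G H (inj₂ x) (inj₂ y) = H x y
sumAdj G H (inj₁ _) (inj₂ _) = false
sumAdj G H (inj₂ _) (inj₁ _) = false

disjointUnion≡sumAdj : ∀ {a b} (G : Adj a) (H : Adj b) i j →
  disjointUnion G H i j ≡ sumAdj G H (splitAt a i) (splitAt a j)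
disjointUnion≡sumAdj {a} G H i j with splitAt a i | splitAt a j
... | inj₁ _ | inj₁ _ = refl
... | inj₁ _ | inj₂ _ = refl
... | inj₂ _ | inj₁ _ = refl
... | inj₂ _ | inj₂ _ = refl

union-depth : ∀ {a b} {G : Adj a} {H : Adj b} {p q} → IsDepth G p → IsDepth H q → ∃ (IsDepth (disjointUnion G H))
union-depth {a} {G = G} {H} {p} {q} G-depth H-depth = [ p , q ] ∘ splitAt a , λ u v e →
  let e-sum = trans (sym (disjointUnion≡sumAdj G H u v)) e
      p≢ , dominates = sum-depth (splitAt a u) (splitAt a v) e-sum
  in p≢ , λ lt w e′ → Sum.map (splitAt-injective a) (trans (disjointUnion≡sumAdj G H u w))
       (dominates lt (splitAt a w) (trans (sym (disjointUnion≡sumAdj G H v w)) e′))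
  where
  sum-depth : ∀ x y → sumAdj G H x y ≡ true → [ p , q ] x ≢ [ p , q ] y ×
    ([ p , q ] x < [ p , q ] y → ∀ z → sumAdj G H y z ≡ true → z ≡ x ⊎ sumAdj G H x z ≡ true)
  sum-depth (inj₁ x) (inj₁ y) e = proj₁ (G-depth x y e) , λ where
    lt (inj₁ z) e′ → Sum.map₁ (cong inj₁) (proj₂ (G-depth x y e) lt z e′)
  sum-depth (inj₂ x) (inj₂ y) e = proj₁ (H-depth x y e) , λ where
    lt (inj₂ z) e′ → Sum.map₁ (cong inj₂) (proj₂ (H-depth x y e) lt z e′)

iso-depth : ∀ {n} {G H : Adj n} {p} → Isomorphic G H → IsDepth G p → ∃ (IsDepth H)
iso-depth {G = G} {H} {p} (σ , iso) depth = p ∘ from , λ u v e →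
    proj₁ (depth (from u) (from v) (pull e)) ,
    λ lt w e′ → Sum.map from-injective push (proj₂ (depth (from u) (from v) (pull e)) lt (from w) (pull e′))
  where
  open Inverse σ using (to; from; strictlyInverseˡ)
  H≡G : ∀ i j → H i j ≡ G (from i) (from j)
  H≡G i j = trans (sym (cong₂ H (strictlyInverseˡ i) (strictlyInverseˡ j))) (iso (from i) (from j))
  pull : ∀ {i j} → H i j ≡ true → G (from i) (from j) ≡ true
  pull {i} {j} e = trans (sym (H≡G i j)) e
  push : ∀ {i j} → G (from i) (from j) ≡ true → H i j ≡ true
  push {i} {j} e = trans (H≡G i j) e
  from-injective : ∀ {i j} → from i ≡ from j → i ≡ j
  from-injective {i} {j} eq = trans (sym (strictlyInverseˡ i)) (trans (cong to eq) (strictlyInverseˡ j))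

trivially-perfect-depth : ∀ {n} {G : Adj n} → TriviallyPerfect G → ∃ (IsDepth G)
trivially-perfect-depth tp-single        = (λ _ → 0) , λ _ _ ()
trivially-perfect-depth (tp-cone G)      = cone-depth (proj₂ (trivially-perfect-depth G))
trivially-perfect-depth (tp-union G H)   = union-depth (proj₂ (trivially-perfect-depth G)) (proj₂ (trivially-perfect-depth H))
trivially-perfect-depth (tp-iso G G≅H)   = iso-depth G≅H (proj₂ (trivially-perfect-depth G))

-- Reversing and composing rotation sequences.

rotation-sym : ∀ {n} {G : Adj n} {T U : SearchTree G} → Rotation {G = G} T U → Rotation {G = G} U T
rotation-sym (X , Y , X∈ , X∉ , Y∈ , Y∉ , onlyX , onlyY) = Y , X , Y∈ , Y∉ , X∈ , X∉ , onlyY , onlyX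

rotation-respˡ : ∀ {n} {G : Adj n} {T T′ U : SearchTree G} → SameTree {G = G} T T′ → Rotation {G = G} T U → Rotation {G = G} T′ U
rotation-respˡ same (X , Y , X∈ , X∉ , Y∈ , Y∉ , onlyX , onlyY) =
  X , Y , proj₁ (same X) X∈ , X∉ , Y∈ , Y∉ ∘ proj₂ (same Y) ,
  (λ Z Z∈ → onlyX Z (proj₂ (same Z) Z∈)) , (λ Z Z∈ Z∉ → onlyY Z Z∈ (Z∉ ∘ proj₁ (same Z)))

same-sym : ∀ {n} {G : Adj n} {T U : SearchTree G} → SameTree {G = G} T U → SameTree {G = G} U T
same-sym same Z = proj₂ (same Z) , proj₁ (same Z)

-- `SameTree` compares tubes only and ignores the order of children, so sequences have to be
-- transported along it.
rotations-respˡ : ∀ {n} {G : Adj n} {k} {T T′ U : SearchTree G} → SameTree {G = G} T T′ → Rotations {G = G} k T U → Rotations {G = G} k T′ U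
rotations-respˡ same (done same′) = done λ Z → proj₁ (same′ Z) ∘ proj₂ (same Z) , proj₁ (same Z) ∘ proj₂ (same′ Z)
rotations-respˡ {G = G} {T = T} {T′} same (step {U = V} rot rots) =
  step {U = V} (rotation-respˡ {G = G} {T} {T′} {V} same rot) rots

rotations-++ : ∀ {n} {G : Adj n} {k l} {T U V : SearchTree G} → Rotations {G = G} k T U → Rotations {G = G} l U V → Rotations {G = G} (k + l) T V
rotations-++ {G = G} {T = T} {U} {V} (done same) rots = rotations-respˡ {T = U} {T} {V} (same-sym {G = G} {T} {U} same) rots
rotations-++ (step {U = W} rot rots) rots′ = step {U = W} rot (rotations-++ rots rots′)

-- As in list reversal with an accumulator, each step of the first sequence is turned round and put
-- in front of the second.
rotations-reverse-++ : ∀ {n} {G : Adj n} {k l} {T U V : SearchTree G} → Rotations {G = G} k T U → Rotations {G = G} l T V → Rotations {G = G} (k + l) U V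
rotations-reverse-++ {T = T} {U} {V} (done same) rots = rotations-respˡ {T = T} {U} {V} same rots
rotations-reverse-++ {G = G} {suc k} {l} {T} {U} {V} (step {U = W} rot rots) rots′ =
  subst (λ m → Rotations m U V) (+-suc k l)
    (rotations-reverse-++ {T = W} rots (step {U = T} (rotation-sym {G = G} {T} {W} rot) rots′))

-- Heaps, their uniqueness and the rotations that correct an edge.

module _ {n} {G : Adj n} (G-sym : ∀ i j → G i j ≡ G j i) {p : Fin n → ℕ} (depth : IsDepth G p) where

  IsMin : Subset n → Fin n → Set
  IsMin S r = r ∈ S × (∀ u → u ∈ S → p r ≤ p u)

  -- Follow a path from `r`. Once `r` is adjacent to a vertex of the path, it is strictly shallower
  -- by minimality and `IsDepth`, so it dominates that vertex and hence equals or is adjacent to the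
  -- next one.
  min-universal : ∀ {S r} → ConnectedOn G S → IsMin S r → ∀ u → u ∈ S → u ≡ r ⊎ G r u ≡ true
  min-universal {S} {r} conn (r∈ , r-min) u u∈ = go (conn r u r∈ u∈) (inj₁ refl)
    where
    go : ∀ {v w} → Path G S v w → v ≡ r ⊎ G r v ≡ true → w ≡ r ⊎ G r w ≡ true
    go (here _) near = near
    go (step _ e π)  (inj₁ refl) = go π (inj₂ e)
    go (step v∈ e π) (inj₂ e′)   =
      go π (proj₂ (depth r _ e′) (≤∧≢⇒< (r-min _ v∈) (proj₁ (depth r _ e′))) _ e)

  -- Two distinct minima would be adjacent vertices of equal depth.
  min-unique : ∀ {S r r′} → ConnectedOn G S → IsMin S r → IsMin S r′ → r′ ≡ r
  min-unique conn r-min@(r∈ , r≤) (r′∈ , r′≤) with min-universal conn r-min _ r′∈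
  ... | inj₁ eq = eq
  ... | inj₂ e  = contradiction (≤-antisym (r≤ _ r′∈) (r′≤ _ r∈)) (proj₁ (depth _ _ e))

  data Heap : Tree n → Set where
    heap : ∀ {r ts} → (∀ u → u ∈ verts (node r ts) → p r ≤ p u) → All Heap ts → Heap (node r ts)

  -- Both roots are the unique minimum of `S`, so the children span the same components, where
  -- induction applies.
  heap-tubes : ∀ t {t′ S} → ConnectedOn G S → IsSearchTree G S t → IsSearchTree G S t′ → Heap t → Heap t′ →
    ∀ Z → Z ∈ₗ tubes t → Z ∈ₗ tubes t′
  heap-tubes = tree-ind go
    where
    P = λ t → ∀ {t′ S} → ConnectedOn G S → IsSearchTree G S t → IsSearchTree G S t′ → Heap t → Heap t′ →
      ∀ Z → Z ∈ₗ tubes t → Z ∈ₗ tubes t′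
    go : ∀ r ts → All P ts → P (node r ts)
    go r ts ih {node r′ ts′} conn st st′ _ _ Z (here refl) =
      here (trans (verts≡ (node r ts) st) (sym (verts≡ (node r′ ts′) st′)))
    go r ts ih {node r′ ts′} {S} conn st@(r∈ , ok , _) st′@(r′∈ , ok′ , _ , cover′) (heap min heaps) (heap min′ heaps′) Z (there Z∈)
      with min-unique conn (r∈ , λ u u∈ → min u (subst (u ∈_) (sym (verts≡ (node r ts) st)) u∈))
                           (r′∈ , λ u u∈ → min′ u (subst (u ∈_) (sym (verts≡ (node r′ ts′) st′)) u∈))
         | ∈tubesL⁻ ts Z∈
    ... | refl | t , t∈ , Z∈t with childOK ok t∈
    ... | comp@(t⊆ , (x , x∈t) , t-conn , _) , t-st with find (cover′ x (t⊆ x∈t))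
    ... | t′ , t′∈ , x∈t′ with childOK ok′ t′∈
    ... | comp′ , t′-st = there (∈tubesL⁺ t′∈ (All.lookup ih t∈ t-conn t-st
            (subst (λ C → IsSearchTree G C t′) (component-unique comp′ comp x∈t′ x∈t) t′-st)
            (All.lookup heaps t∈) (All.lookup heaps′ t′∈) Z Z∈t))

  -- A rotation that corrects the orientation of the edge between `b` and `r` and spoils no other.
  -- It relates predicates on tubes, so that it can speak of a subtree or a list of subtrees and
  -- then be carried over to the whole tree.
  record _⇝_ (P P′ : Subset n → Set) : Set where
    field
      X Y      : Subset n
      X∈P      : P X
      X∉P′     : ¬ P′ X
      Y∈P′     : P′ Y
      Y∉P      : ¬ P Y
      onlyX    : ∀ Z → P Z → ¬ P′ Z → Z ≡ X
      onlyY    : ∀ Z → P′ Z → ¬ P Z → Z ≡ Y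
      {b r}    : Fin n
      edge     : G b r ≡ true
      b<r      : p b < p r
      before   : Below P b r
      after    : Below P′ r b
      no-worse : ∀ u v → G u v ≡ true → p u < p v → Below P′ u v → Below P u v

  -- `Q` holds the tubes outside the rotated part, present before and after. Disjointness from `P`
  -- and `P′` keeps `X` lost and `Y` new.
  ⇝-context : ∀ {P P′ R R′ Q : Subset n → Set} → P ⇝ P′ →
    (∀ Z → R Z → Q Z ⊎ P Z) → (∀ Z → Q Z ⊎ P Z → R Z) →
    (∀ Z → R′ Z → Q Z ⊎ P′ Z) → (∀ Z → Q Z ⊎ P′ Z → R′ Z) →
    (∀ Z → Q Z → ¬ P Z) → (∀ Z → Q Z → ¬ P′ Z) → R ⇝ R′
  ⇝-context {P} {P′} {R} {R′} rot R⁻ R⁺ R′⁻ R′⁺ Q-P Q-P′ = record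
    { X = X ; Y = Y
    ; X∈P  = R⁺ X (inj₂ X∈P)
    ; X∉P′ = λ X∈R′ → [ (λ q → Q-P X q X∈P) , X∉P′ ] (R′⁻ X X∈R′)
    ; Y∈P′ = R′⁺ Y (inj₂ Y∈P′)
    ; Y∉P  = λ Y∈R → [ (λ q → Q-P′ Y q Y∈P′) , Y∉P ] (R⁻ Y Y∈R)
    ; onlyX = λ Z Z∈ Z∉ → [ (λ q → contradiction (R′⁺ Z (inj₁ q)) Z∉) , (λ Z∈P → onlyX Z Z∈P (Z∉ ∘ R′⁺ Z ∘ inj₂)) ] (R⁻ Z Z∈)
    ; onlyY = λ Z Z∈ Z∉ → [ (λ q → contradiction (R⁺ Z (inj₁ q)) Z∉) , (λ Z∈P′ → onlyY Z Z∈P′ (Z∉ ∘ R⁺ Z ∘ inj₂)) ] (R′⁻ Z Z∈)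
    ; edge = edge ; b<r = b<r
    ; before = into before
    ; after  = let Z , Z∈ , rb = after in Z , R′⁺ Z (inj₂ Z∈) , rb
    ; no-worse = λ u v e lt (Z , Z∈ , uv) →
        [ (λ q → Z , R⁺ Z (inj₁ q) , uv) , (λ Z∈P′ → into (no-worse u v e lt (Z , Z∈P′ , uv))) ] (R′⁻ Z Z∈)
    }
    where
    open _⇝_ rot
    into : ∀ {u v} → Below P u v → Below R u v
    into (Z , Z∈ , uv) = Z , R⁺ Z (inj₂ Z∈) , uv

  -- Deleting `b` first leaves the trees of `ts` with `r` grafted onto them, so only `X` is lost and
  -- only `Y` is new. The minimum `b` is adjacent to `r`, and this is the corrected edge.
  rotate-root : ∀ {S r b ts} → ConnectedOn G S → IsSearchTree G S (node r (node b ts ∷ [])) → (∀ u → u ∈ S → p b ≤ p u) →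
    IsSearchTree G S (node b (graft G-sym r ts)) ×
    (_∈ₗ tubes (node r (node b ts ∷ []))) ⇝ (_∈ₗ tubes (node b (graft G-sym r ts)))
  rotate-root {S} {r} {b} {ts} conn old-st@(r∈ , ((X-comp@(X⊆ , _) , X-st@(_ , X-forest)) , _) , _ , cover) b-min =
    new-st , record
      { X = X ; Y = Y
      ; X∈P  = there (here refl)
      ; X∉P′ = λ { (here eq) → r∉X (subst (r ∈_) (trans (sym new≡S) (sym eq)) r∈)
                 ; (there X∈) → [ (λ eq → r∉X (subst (r ∈_) (sym eq) r∈Y)) , X∉ts ] (graft-tubes⁻ G-sym r ts X∈) }
      ; Y∈P′ = there (here refl)
      ; Y∉P  = λ { (here eq) → b∉Y (subst (b ∈_) (trans (sym old≡S) (sym eq)) b∈)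
                 ; (there Y∈) → r∉X (tube⊆verts (node b ts) (tubes-singleton⁻ (node b ts) Y∈) r∈Y) }
      ; onlyX = onlyX ; onlyY = onlyY
      ; edge = b~r
      ; b<r = ≤∧≢⇒< (b-min r r∈) (proj₁ (depth b r b~r))
      ; before = X , there (here refl) , b∈X , r∉X
      ; after  = Y , there (here refl) , r∈Y , b∉Y
      ; no-worse = no-worse
      }
    where
    X = verts (node b ts)
    Y = verts (node r (touching G-sym r ts))
    old = node r (node b ts ∷ [])
    new = node b (graft G-sym r ts)

    b∈X : b ∈ X
    b∈X = root∈verts {ts = ts}

    r∈Y : r ∈ Y
    r∈Y = root∈verts {ts = touching G-sym r ts}

    r∉X : r ∉ X
    r∉X r∈X = x∈p-y⇒x≢y {p = S} (X⊆ r∈X) refl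

    b∈ : b ∈ S
    b∈ = x∈p-y⇒x∈p (X⊆ b∈X)

    b~r : G b r ≡ true
    b~r with min-universal conn (b∈ , b-min) r r∈
    ... | inj₁ refl = contradiction b∈X r∉X
    ... | inj₂ e    = e

    X≡S-r : X ≡ S - r
    X≡S-r = ⊆-antisym X⊆ covered
      where
      covered : ∀ {x} → x ∈ S - r → x ∈ X
      covered x∈ with here x∈X ← cover _ x∈ = x∈X

    new-forest : Forest G (S - b) (graft G-sym r ts)
    -- The only child of `r` spans `S - r`, so `ts` is a forest on `S - r - b`, which equals
    -- `S - b - r`.
    new-forest = graft-forest G-sym (x∈p∧x≢y⇒x∈p-y r∈ λ { refl → r∉X b∈X })
      (subst (λ C → Forest G C ts) (trans (cong (_- b) X≡S-r) (p─x─y≡p─y─x S r b)) X-forest)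

    new-st : IsSearchTree G S new
    new-st = b∈ , new-forest

    old≡S : verts old ≡ S
    old≡S = verts≡ old old-st

    new≡S : verts new ≡ S
    new≡S = verts≡ new new-st

    Y-comp : IsComponent G (S - b) Y
    Y-comp = proj₁ (proj₁ (proj₁ new-forest))

    b∉Y : b ∉ Y
    b∉Y b∈Y = x∈p-y⇒x≢y {p = S} (proj₁ Y-comp b∈Y) refl

    X∉ts : X ∉ₗ tubesL ts
    X∉ts X∈ts = x∈p-y⇒x≢y {p = X} (vertsL⊆ ts (proj₁ X-forest) (tube⊆vertsL ts X∈ts b∈X)) refl

    onlyX : ∀ Z → Z ∈ₗ tubes old → Z ∉ₗ tubes new → Z ≡ X
    onlyX Z (here eq) Z∉ = contradiction (here (trans eq (trans old≡S (sym new≡S)))) Z∉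
    onlyX Z (there Z∈) Z∉ with tubes-singleton⁻ (node b ts) Z∈
    ... | here eq     = eq
    ... | there Z∈ts  = contradiction (there (graft-tubes⁺ G-sym r ts Z∈ts)) Z∉

    onlyY : ∀ Z → Z ∈ₗ tubes new → Z ∉ₗ tubes old → Z ≡ Y
    onlyY Z (here eq) Z∉ = contradiction (here (trans eq (trans new≡S (sym old≡S)))) Z∉
    onlyY Z (there Z∈) Z∉ with graft-tubes⁻ G-sym r ts Z∈
    ... | inj₁ eq   = eq
    ... | inj₂ Z∈ts = contradiction (there (there (∈-++⁺ˡ Z∈ts))) Z∉

    no-worse : ∀ u v → G u v ≡ true → p u < p v → Below (_∈ₗ tubes new) u v → Below (_∈ₗ tubes old) u v
    no-worse u v e lt (Z , here refl , uv) = verts old , here refl , subst (λ C → u ∈ C × v ∉ C) (trans new≡S (sym old≡S)) uv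
    no-worse u v e lt (Z , there Z∈ , u∈Z , v∉Z) with graft-tubes⁻ G-sym r ts Z∈
    ... | inj₂ Z∈ts = Z , there (there (∈-++⁺ˡ Z∈ts)) , u∈Z , v∉Z
    ... | inj₁ refl with u∈S ← x∈p-y⇒x∈p {p = S} (proj₁ Y-comp u∈Z) | v ∈? S
    ...   | no v∉S = verts old , here refl , subst (u ∈_) (sym old≡S) u∈S , v∉S ∘ subst (v ∈_) old≡S
    -- `Y` is a component of `S - b`, so an edge leaving it within `S` ends at `b`, and `p u < p b`
    -- contradicts minimality.
    ...   | yes v∈S with v ≟ b
    ...     | yes refl = contradiction (b-min u u∈S) (<⇒≱ lt)
    ...     | no v≢b   = contradiction (proj₂ (proj₂ (proj₂ Y-comp)) u v u∈Z (x∈p∧x≢y⇒x∈p-y v∈S v≢b) e) v∉Z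

  -- Locating a correcting rotation.

  Improvable : Subset n → Tree n → Set
  Improvable S t = ∃ λ t′ → IsSearchTree G S t′ × (_∈ₗ tubes t) ⇝ (_∈ₗ tubes t′)

  -- Keeping `vertsL` fixed lets the parent retain its own tube and its covering property.
  ImprovableL : Subset n → List (Tree n) → Set
  ImprovableL S ts = ∃ λ ts′ → vertsL ts′ ≡ vertsL ts × ChildrenOK G S ts′ × AllPairs DisjointTrees ts′ ×
    (_∈ₗ tubesL ts) ⇝ (_∈ₗ tubesL ts′)

  -- The first improvable child is rotated, and the tubes of its siblings form the context.
  improve-children : ∀ {S} ts → All (λ t → ∀ {S} → ConnectedOn G S → IsSearchTree G S t → Heap t ⊎ Improvable S t) ts →
    ChildrenOK G S ts → AllPairs DisjointTrees ts → All Heap ts ⊎ ImprovableL S ts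
  improve-children [] [] _ _ = inj₁ []
  improve-children {S} (t ∷ ts) (ih ∷ ihs) ((comp , st) , ok) (d ∷ ds) with ih (proj₁ (proj₂ (proj₂ comp))) st
  ... | inj₂ (t′ , st′ , rot) = inj₂ (t′ ∷ ts , cong (_∪ vertsL ts) t′≡t
      , ((subst (IsComponent G S) (sym t′≡t) comp , subst (λ C → IsSearchTree G C t′) (sym t′≡t) st′) , ok)
      , (d′ ∷ ds)
      , ⇝-context {Q = _∈ₗ tubesL ts} rot
          (λ Z → Sum.swap ∘ ∈-++⁻ (tubes t)) (λ Z → [ ∈-++⁺ʳ (tubes t) , ∈-++⁺ˡ ])
          (λ Z → Sum.swap ∘ ∈-++⁻ (tubes t′)) (λ Z → [ ∈-++⁺ʳ (tubes t′) , ∈-++⁺ˡ ])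
          (λ Z Z∈ts Z∈t → disjoint-tubes d Z Z∈t Z∈ts) (λ Z Z∈ts Z∈t′ → disjoint-tubes d′ Z Z∈t′ Z∈ts))
    where
    t′≡t : verts t′ ≡ verts t
    t′≡t = verts≡ t′ st′
    d′ : All (DisjointTrees t′) ts
    d′ = subst (λ C → All (λ u → Disjoint C (verts u)) ts) (sym t′≡t) d
  ... | inj₁ h with improve-children ts ihs ok ds
  ...   | inj₁ hs = inj₁ (h ∷ hs)
  ...   | inj₂ (ts′ , eq , ok′ , ds′ , rot) = inj₂ (t ∷ ts′ , cong (verts t ∪_) eq , ((comp , st) , ok′) , (d′ ∷ ds′)
      , ⇝-context {Q = _∈ₗ tubes t} rot
          (λ Z → ∈-++⁻ (tubes t)) (λ Z → [ ∈-++⁺ˡ , ∈-++⁺ʳ (tubes t) ])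
          (λ Z → ∈-++⁻ (tubes t)) (λ Z → [ ∈-++⁺ˡ , ∈-++⁺ʳ (tubes t) ])
          (disjoint-tubes d) (disjoint-tubes d′))
    where
    d′ : All (DisjointTrees t) ts′
    d′ = All.tabulate λ u∈ x x∈t x∈u →
      let w , w∈ , x∈w = ∈vertsL⁻ ts (subst (x ∈_) eq (∈vertsL⁺ u∈ x∈u)) in All.lookup d w∈ x x∈t x∈w

  -- Every component of `S - r` contains `b` or a neighbour of `b`, hence `b` itself; two components
  -- would share it.
  universal-only-child : ∀ {S r b ts} → IsSearchTree G S (node r ts) → b ∈ S → b ≢ r →
    (∀ u → u ∈ S → u ≡ b ⊎ G b u ≡ true) → ∃ λ t → ts ≡ t ∷ []
  universal-only-child {ts = []} (_ , _ , _ , cover) b∈ b≢r _ with () ← cover _ (x∈p∧x≢y⇒x∈p-y b∈ b≢r)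
  universal-only-child {ts = t ∷ []} _ _ _ _ = t , refl
  universal-only-child {S} {r} {b} {t ∷ t′ ∷ _} (_ , ((comp , _) , (comp′ , _) , _) , ((d ∷ _) ∷ _) , _) b∈ b≢r univ =
    contradiction (contains comp′) (d b (contains comp))
    where
    contains : ∀ {C} → IsComponent G (S - r) C → b ∈ C
    contains (C⊆ , (x , x∈) , _ , closed) with univ x (x∈p-y⇒x∈p (C⊆ x∈))
    ... | inj₁ refl = x∈
    ... | inj₂ e    = closed x b x∈ (x∈p∧x≢y⇒x∈p-y b∈ b≢r) (trans (G-sym x b) e)

  -- If all children are heaps and some minimum `b` differs from the root, `b` is adjacent to
  -- everything else in `S`, so there is one child only and its root can be rotated up.
  heap-or-improvable : ∀ t {S} → ConnectedOn G S → IsSearchTree G S t → Heap t ⊎ Improvable S t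
  heap-or-improvable = tree-ind go
    where
    P = λ t → ∀ {S} → ConnectedOn G S → IsSearchTree G S t → Heap t ⊎ Improvable S t
    go : ∀ r ts → All P ts → P (node r ts)
    go r ts ih {S} conn st@(r∈ , ok , disj , cover) with improve-children ts ih ok disj
    ... | inj₂ (ts′ , eq , ok′ , disj′ , rot) = inj₂ (node r ts′ , (r∈ , ok′ , disj′ , cover′)
        -- The context is the root tube alone, told apart from the tubes of the children by
        -- containing `r`.
        , ⇝-context {Q = _≡ verts (node r ts)} rot
            (λ { Z (here e) → inj₁ e ; Z (there Z∈) → inj₂ Z∈ }) (λ Z → [ here , there ])
            (λ { Z (here e) → inj₁ (trans e same) ; Z (there Z∈) → inj₂ Z∈ })
            (λ Z → [ (λ e → here (trans e (sym same))) , there ])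
            (λ { Z refl Z∈ → r∉L ts ok (tube⊆vertsL ts Z∈ (root∈verts {ts = ts})) })
            (λ { Z refl Z∈ → r∉L ts′ ok′ (tube⊆vertsL ts′ Z∈ (root∈verts {ts = ts})) }))
      where
      same : verts (node r ts′) ≡ verts (node r ts)
      same = cong (⁅ r ⁆ ∪_) eq
      r∉L : ∀ us → ChildrenOK G (S - r) us → r ∉ vertsL us
      r∉L us us-ok r∈us = x∈p-y⇒x≢y {p = S} (vertsL⊆ us us-ok r∈us) refl
      cover′ : ∀ v → v ∈ S - r → Any (λ t → v ∈ verts t) ts′
      cover′ v v∈ = let t , t∈ , v∈t = find (cover v v∈)
                        u , u∈ , v∈u = ∈vertsL⁻ ts′ (subst (v ∈_) (sym eq) (∈vertsL⁺ t∈ v∈t))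
                    in lose u∈ v∈u
    ... | inj₁ heaps with argmin p r∈
    ... | b , b∈ , b-min with b ≟ r
    ...   | yes refl = inj₁ (heap (λ u u∈ → b-min u (subst (u ∈_) (verts≡ (node r ts) st) u∈)) heaps)
    ...   | no b≢r with universal-only-child st b∈ b≢r (min-universal conn (b∈ , b-min))
    ...     | node b′ us , refl with heaps | cover b (x∈p∧x≢y⇒x∈p-y b∈ b≢r)
    ...       | heap b′-min _ ∷ [] | here b∈t =
                -- `b` lies in the child heap, so the root `b′` is no deeper than `b` and is itself
                -- minimal in `S`.
                inj₂ (_ , rotate-root conn st (λ u u∈ → ≤-trans (b′-min b b∈t) (b-min u u∈)))

  -- Counting wrongly oriented edges.

  Wrong : List (Subset n) → Fin n → Fin n → Set
  Wrong L i j = EdgeAt G i j × ((p i < p j × Below (_∈ₗ L) i j) ⊎ (p j < p i × Below (_∈ₗ L) j i))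

  wrong? : ∀ L i j → Dec (Wrong L i j)
  wrong? L i j = ((G i j ≟ᵇ true) ×-dec (toℕ i <? toℕ j)) ×-dec
    (((p i <? p j) ×-dec below? L i j) ⊎-dec ((p j <? p i) ×-dec below? L j i))

  wrongs : Tree n → ℕ
  wrongs t = Σ₂ (λ i j → ind (wrong? (tubes t) i j))

  wrongs≤edges : ∀ t → wrongs t ≤ edges G
  wrongs≤edges t = Σ₂-mono λ i j → ind≤edgeTerm {G = G} (wrong? (tubes t) i j) i j proj₁

  -- `no-worse` prevents new wrong edges, while the edge between `b` and `r` is wrong by `before`
  -- and right by `after` with `below-exclusive`.
  improvement : ∀ {S} t t′ → IsSearchTree G S t′ → (_∈ₗ tubes t) ⇝ (_∈ₗ tubes t′) → wrongs t′ < wrongs t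
  improvement t t′ st′ rot = by-order (<-cmp (toℕ b) (toℕ r))
    where
    open _⇝_ rot
    still-wrong : ∀ i j → Wrong (tubes t′) i j → Wrong (tubes t) i j
    still-wrong i j (e , w) = e , Sum.map
      (λ (lt , below) → lt , no-worse i j (proj₁ e) lt below)
      (λ (lt , below) → lt , no-worse j i (trans (G-sym j i) (proj₁ e)) lt below) w
    corrected : ¬ Below (_∈ₗ tubes t′) b r
    corrected b↓r = below-exclusive t′ st′ edge b↓r after
    strict : ∀ i j → ¬ Wrong (tubes t′) i j → Wrong (tubes t) i j → wrongs t′ < wrongs t
    strict i j right wrong = Σ₂-strict i j
      (λ i j → ind-mono (wrong? (tubes t′) i j) (wrong? (tubes t) i j) (still-wrong i j))
      (ind-strict (wrong? (tubes t′) i j) (wrong? (tubes t) i j) right wrong)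
    -- `EdgeAt` lists each edge once, smaller index first, so the corrected edge is counted at `b r`
    -- or at `r b`.
    by-order : Tri (toℕ b < toℕ r) (toℕ b ≡ toℕ r) (toℕ r < toℕ b) → wrongs t′ < wrongs t
    by-order (tri< lt _ _) = strict b r
      (λ { (_ , inj₁ (_ , b↓r)) → corrected b↓r ; (_ , inj₂ (r<b , _)) → <-asym b<r r<b })
      ((edge , lt) , inj₁ (b<r , before))
    by-order (tri≈ _ eq _) = contradiction b<r (<-irrefl (cong p (toℕ-injective eq)))
    by-order (tri> _ _ gt) = strict r b
      (λ { (_ , inj₁ (r<b , _)) → <-asym b<r r<b ; (_ , inj₂ (_ , b↓r)) → corrected b↓r })
      ((trans (G-sym r b) edge , gt) , inj₂ (b<r , before))

  -- The upper bound.

  ⇝⇒Rotation : ∀ {t t′} {st : IsSearchTree G ⊤ t} {st′ : IsSearchTree G ⊤ t′} →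
    (_∈ₗ tubes t) ⇝ (_∈ₗ tubes t′) → Rotation {G = G} (t , st) (t′ , st′)
  ⇝⇒Rotation rot = X , Y , X∈P , X∉P′ , Y∈P′ , Y∉P , onlyX , onlyY
    where open _⇝_ rot

  -- The bound `m` on the number of wrong edges decreases with every rotation, so it gives both
  -- termination and the length.
  rotations-to-heap : Connected G → ∀ m (T : SearchTree G) → wrongs (proj₁ T) ≤ m →
    Σ (SearchTree G) λ C → Heap (proj₁ C) × ∃ λ k → k ≤ m × Rotations {G = G} k T C
  rotations-to-heap conn m (t , st) bound with heap-or-improvable t conn st
  ... | inj₁ h = (t , st) , h , 0 , z≤n , done λ _ → id , id
  ... | inj₂ (t′ , st′ , rot) with m | ≤-trans (improvement t t′ st′ rot) bound
  ...   | suc m′ | s≤s bound′ with rotations-to-heap conn m′ (t′ , st′) bound′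
  ...     | C , h , k , k≤ , rots =
    C , h , suc k , s≤s k≤ , step {U = t′ , st′} (⇝⇒Rotation {st = st} {st′} rot) rots

  diameter-upper : Connected G → ∀ (T T′ : SearchTree G) → Σ ℕ λ k → k ≤ 2 * edges G × Rotations {G = G} k T T′
  diameter-upper conn T T′ with rotations-to-heap conn (edges G) T (wrongs≤edges (proj₁ T))
                              | rotations-to-heap conn (edges G) T′ (wrongs≤edges (proj₁ T′))
  ... | C , h , k , k≤ , T→C | C′ , h′ , k′ , k′≤ , T′→C′ =
    -- `k′ + 0` is the length of the reversed sequence followed by an empty one, and it matches the
    -- unfolding of `2 * edges G`.
    k + (k′ + 0) , +-mono-≤ k≤ (+-mono-≤ k′≤ z≤n) ,
    rotations-++ {U = C} T→C (rotations-respˡ {T = C′} {C} C′≈C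
      (rotations-reverse-++ {T = T′} {C′} {T′} T′→C′ (done λ _ → id , id)))
    where
    C′≈C : SameTree {G = G} C′ C
    C′≈C Z = heap-tubes _ conn (proj₂ C′) (proj₂ C) h′ h Z , heap-tubes _ conn (proj₂ C) (proj₂ C′) h h′ Z

theorem3 : Σ ℕ λ a → Σ ℕ λ b → 1 ≤ a × 1 ≤ b ×
    (∀ n (G : Adj n) → IsSimple G → Connected G → TriviallyPerfect G → 1 ≤ edges G →
    (Σ (SearchTree G) λ T → Σ (SearchTree G) λ T' →
    ∀ k → Rotations k T T' → edges G ≤ a * k)
    × (∀ (T T' : SearchTree G) → Σ ℕ λ k → k ≤ b * edges G × Rotations k T T'))
-- `1` because a rotation reorients at most one edge; `2` because the route goes from `T` to the
-- heap and on to `T'`.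
theorem3 = 1 , 2 , s≤s z≤n , s≤s z≤n , bounds
  where
  bounds : ∀ n (G : Adj n) → IsSimple G → Connected G → TriviallyPerfect G → 1 ≤ edges G →
    (Σ (SearchTree G) λ T → Σ (SearchTree G) λ T' → ∀ k → Rotations k T T' → edges G ≤ 1 * k)
    × (∀ (T T' : SearchTree G) → Σ ℕ λ k → k ≤ 2 * edges G × Rotations k T T')
  -- With no vertices `edges G` computes to `0`; otherwise `zero` is the vertex that
  -- `diameter-lower` asks for.
  bounds zero G _ _ _ ()
  bounds (suc n) G (G-sym , _) conn tp _ =
    let T , T′ , lower = diameter-lower G G-sym conn zero
    in (T , T′ , λ k rots → subst (edges G ≤_) (sym (+-identityʳ k)) (lower k rots))
     , diameter-upper G-sym (proj₂ (trivially-perfect-depth tp)) conn
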